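{- There is a constant $c>0$ such that for every $d\ge1$ the hypercube $G$ with $n=2^d$ vertices satisfies $\widetilde{\mathsf{VC}}(G)\ge c\,n\log^2 n$.
   Context: The hypercube has vertex set $\{0,1\}^d$, two vertices adjacent iff they differ in exactly one bit; logarithms are base 2. Unweighted deterministic walk: each vertex $u$ has a rotor sequence of length $\tilde d(u)$ of neighbours of $u$, each occurring exactly $\tilde d(u)/\deg(u)$ times, and an initial rotor position; the walk moves from the current vertex to the vertex its rotor points at and then advances that rotor cyclically. $\widetilde{\mathsf{VC}}(G)$ is the maximum over start vertices and all rotor sequences/initial positions (lengths fixed) of the least $t$ by which all vertices have been visited. -}

module Defs where

open import Data.Bool using (Bool)
open import Data.Bool.Properties using () renaming (_≟_ to _≟B_)
open import Data.Nat using (ℕ; zero; suc; _+_; _*_; _≤_; _<_; _<?_)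
open import Data.Fin using (Fin; zero; suc; toℕ; fromℕ<)
open import Data.Vec using (Vec; lookup)
open import Data.Vec.Properties using (≡-dec)
open import Data.List using (List; length; filter; allFin)
open import Data.Product using (Σ; ∃; _×_; _,_; proj₁; proj₂)
open import Relation.Nullary using (¬_; Dec; yes; no)
open import Relation.Binary.PropositionalEquality using (_≡_; _≢_; refl)

V : ℕ → Set
V d = Vec Bool d

_≟V_ : ∀ {d} (u v : V d) → Dec (u ≡ v)
_≟V_ = ≡-dec _≟B_

nV : ℕ → ℕ
nV d = 2 Data.Nat.^ d

countEq : ∀ {A : Set} (_≟_ : (a b : A) → Dec (a ≡ b)) {L : ℕ} → (Fin L → A) → A → ℕ
countEq _≟_ {L} f x = length (filter (λ i → f i ≟ x) (allFin L))

hamming : ∀ {d} → V d → V d → ℕ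
hamming {d} u v = length (filter (λ i → Relation.Nullary.¬? (lookup u i ≟B lookup v i)) (allFin d))

Adj : ∀ {d} → V d → V d → Set
Adj u v = hamming u v ≡ 1

-- A rotor system for the hypercube with rotor lengths  d̃(u) = m u * d,
-- i.e. every neighbour of u occurs exactly m u = d̃(u)/deg(u) times (deg(u) = d).
record RotorSystem (d : ℕ) (m : V d → ℕ) : Set where
  field
    rotor     : (u : V d) → Fin (m u * d) → V d
    rotorAdj  : ∀ u i → Adj u (rotor u i)
    rotorMult : ∀ u v → Adj u v → countEq _≟V_ (rotor u) v ≡ m u
open RotorSystem public

cyc : ∀ {n} → Fin n → Fin n
cyc {suc n} i with suc (toℕ i) <? suc n
... | yes p = fromℕ< p
... | no _  = zero

Positions : (d : ℕ) (m : V d → ℕ) → Set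
Positions d m = (u : V d) → Fin (m u * d)

advance : ∀ {d m} → Positions d m → V d → Positions d m
advance p x u with u ≟V x
... | yes refl = cyc (p x)
... | no _     = p u

State : (d : ℕ) (m : V d → ℕ) → Set
State d m = V d × Positions d m

step : ∀ {d m} → RotorSystem d m → State d m → State d m
step {d} {m} R (x , p) = rotor R x (p x) , advance {d} {m} p x

walk : ∀ {d m} → RotorSystem d m → State d m → ℕ → State d m
walk R s zero    = s
walk R s (suc t) = step R (walk R s t)

AllVisited : ∀ {d m} → RotorSystem d m → State d m → ℕ → Set
AllVisited {d} R s t = ∀ (v : V d) → ∃ λ t' → t' ≤ t × proj₁ (walk R s t') ≡ v

IsCoverTime : ∀ {d m} → RotorSystem d m → State d m → ℕ → Set
IsCoverTime R s t = AllVisited R s t × (∀ t' → t' < t → ¬ AllVisited R s t')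

-- VC~(Q_d) with lengths m u * d is at least T: some start vertex, rotor
-- sequences and initial rotor positions give a cover time ≥ T.
-- (VC~ is the maximum of these cover times.)
VCAtLeast : (d : ℕ) (m : V d → ℕ) → ℕ → Set
VCAtLeast d m T = Σ (RotorSystem d m) λ R → Σ (State d m) λ s →
  ∃ λ t → IsCoverTime R s t × T ≤ t

{-# OPTIONS --safe #-}
module Submission where

-- Every rotor repeats one fixed round through the d neighbours, those closer
-- to the start 𝟎 first.  Let the k-th phase end when 𝟎 has been left k d times
-- and the walk is back at 𝟎.  At that moment each edge between levels l and
-- l + 1 has been used exactly k ∸ l times in each direction: "at most" holds
-- because inflow bounds the number of exits at every time of the phase, and
-- "at least" follows level by level, since at the end of a phase inflow equals
-- the number of exits and a vertex below its bound would deprive a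
-- down-neighbour of inflow.  So the walk sits on levels ≤ k during phase k; the
-- vertex 𝟏 is reached only after phase d − 1, whose duration
-- Σᵤ (d (d − 1) − (d − 1) |u|) is 2ᵈ d (d − 1) / 2, while phase d ends with all
-- vertices visited.

open import Defs
open import Data.Bool using (Bool; true; false; if_then_else_; not)
open import Data.Bool.Properties using (not-involutive) renaming (_≟_ to _≟B_)
open import Data.Fin using (Fin; zero; suc; toℕ; fromℕ<)
open import Data.Fin.Properties using (toℕ<n; toℕ-fromℕ<) renaming (_≟_ to _≟F_)
open import Data.List using (List; []; _∷_; _++_; map; length; filter; tabulate)
open import Data.List.Properties using (length-map; length-++; ++-identityʳ)
open import Data.Nat
open import Data.Nat.DivMod
open import Data.Nat.Properties
open import Algebra.Properties.Semiring.Sum +-*-semiring using (sum; sum-cong-≗; ∑-distrib-+; sum-replicate-zero)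
open import Data.Nat.Tactic.RingSolver using (solve-∀)
open import Data.Product using (Σ; ∃; _×_; _,_; proj₁; proj₂)
open import Data.Vec using ([]; _∷_; lookup; updateAt; replicate)
open import Data.Vec.Properties using (updateAt-updateAt-local; updateAt-id-local; lookup∘updateAt; ∷-injectiveʳ)
open import Function using (_∘_; id)
open import Relation.Nullary using (¬_; ¬?; Dec; yes; no; does; contradiction)
open import Relation.Nullary.Decidable using (dec-true; dec-false; map′; _×-dec_)
open import Relation.Binary.PropositionalEquality

private variable
  A B : Set
  n : ℕ

-- Indicators and finite sums.

⟦_⟧ : Dec A → ℕ
⟦ a? ⟧ = if does a? then 1 else 0

⟦⟧-yes : (a? : Dec A) → A → ⟦ a? ⟧ ≡ 1
⟦⟧-yes a? a = cong (if_then 1 else 0) (dec-true a? a)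

⟦⟧-no : (a? : Dec A) → ¬ A → ⟦ a? ⟧ ≡ 0
⟦⟧-no a? ¬a = cong (if_then 1 else 0) (dec-false a? ¬a)

⟦⟧-cong : (a? : Dec A) (b? : Dec B) → (A → B) → (B → A) → ⟦ a? ⟧ ≡ ⟦ b? ⟧
⟦⟧-cong (yes a) b? f g = sym (⟦⟧-yes b? (f a))
⟦⟧-cong (no ¬a) b? f g = sym (⟦⟧-no b? (¬a ∘ g))

bit : Bool → ℕ
bit b = if b then 1 else 0

sum-const : ∀ n c → sum {n} (λ _ → c) ≡ n * c
sum-const zero    c = refl
sum-const (suc n) c = cong (c +_) (sum-const n c)

sum-mono-≤ : {f g : Fin n → ℕ} → (∀ i → f i ≤ g i) → sum f ≤ sum g
sum-mono-≤ {zero}  f≤g = z≤n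
sum-mono-≤ {suc n} f≤g = +-mono-≤ (f≤g zero) (sum-mono-≤ (f≤g ∘ suc))

sum-mono-< : {f g : Fin n → ℕ} → (∀ i → f i ≤ g i) → ∀ i → f i < g i → sum f < sum g
sum-mono-< f≤g zero    fi<gi = +-mono-<-≤ fi<gi (sum-mono-≤ (f≤g ∘ suc))
sum-mono-< f≤g (suc i) fi<gi = +-mono-≤-< (f≤g zero) (sum-mono-< (f≤g ∘ suc) i fi<gi)

sum-δ : (f : Fin n → ℕ) (j : Fin n) → sum (λ i → f i * ⟦ j ≟F i ⟧) ≡ f j
sum-δ {suc n} f zero = begin
  f zero * 1 + sum (λ i → f (suc i) * 0)  ≡⟨ cong₂ _+_ (*-identityʳ (f zero)) (trans (sum-cong-≗ (λ i → *-zeroʳ (f (suc i)))) (sum-replicate-zero n)) ⟩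
  f zero + 0                              ≡⟨ +-identityʳ (f zero) ⟩
  f zero                                  ∎
  where open ≡-Reasoning
sum-δ {suc n} f (suc j) = cong₂ _+_ (*-zeroʳ (f zero)) (sum-δ (f ∘ suc) j)

length-filter-tabulate : {P : A → Set} (P? : ∀ x → Dec (P x)) (f : Fin n → A) →
                         length (filter P? (tabulate f)) ≡ sum (λ i → ⟦ P? (f i) ⟧)
length-filter-tabulate {n = zero}  P? f = refl
length-filter-tabulate {n = suc n} P? f with does (P? (f zero))
... | true  = cong suc (length-filter-tabulate P? (f ∘ suc))
... | false = length-filter-tabulate P? (f ∘ suc)

-- Sums over initial segments of ℕ and over lists.

sumTo : ℕ → (ℕ → ℕ) → ℕ
sumTo n g = sum {n} (g ∘ toℕ)

sumTo-+ : ∀ a b (g : ℕ → ℕ) → sumTo (a + b) g ≡ sumTo a g + sumTo b (λ j → g (a + j))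
sumTo-+ zero    b g = refl
sumTo-+ (suc a) b g = trans (cong (g 0 +_) (sumTo-+ a b (g ∘ suc))) (sym (+-assoc (g 0) _ _))

sumTo-suc : ∀ n (g : ℕ → ℕ) → sumTo (suc n) g ≡ sumTo n g + g n
sumTo-suc zero    g = +-identityʳ (g 0)
sumTo-suc (suc n) g = trans (cong (g 0 +_) (sumTo-suc n (g ∘ suc))) (sym (+-assoc (g 0) _ _))

sumTo-cong : ∀ n {f g : ℕ → ℕ} → (∀ j → j < n → f j ≡ g j) → sumTo n f ≡ sumTo n g
sumTo-cong n eq = sum-cong-≗ (λ i → eq (toℕ i) (toℕ<n i))

-- Reading past the end of the list gives the default value.
nth : A → List A → ℕ → A
nth z []       j       = z
nth z (x ∷ xs) zero    = x
nth z (x ∷ xs) (suc j) = nth z xs j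

sumL : (A → ℕ) → List A → ℕ
sumL g []       = 0
sumL g (x ∷ xs) = g x + sumL g xs

sumL-++ : (g : A → ℕ) (xs ys : List A) → sumL g (xs ++ ys) ≡ sumL g xs + sumL g ys
sumL-++ g []       ys = refl
sumL-++ g (x ∷ xs) ys = trans (cong (g x +_) (sumL-++ g xs ys)) (sym (+-assoc (g x) _ _))

sumL-map : (g : B → ℕ) (f : A → B) (xs : List A) → sumL g (map f xs) ≡ sumL (g ∘ f) xs
sumL-map g f []       = refl
sumL-map g f (x ∷ xs) = cong (g (f x) +_) (sumL-map g f xs)

sumL-0 : (xs : List A) → sumL (λ _ → 0) xs ≡ 0
sumL-0 []       = refl
sumL-0 (x ∷ xs) = sumL-0 xs

sumTo-nth : (z : A) (g : A → ℕ) (xs ys : List A) →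
            sumTo (length xs) (g ∘ nth z (xs ++ ys)) ≡ sumL g xs
sumTo-nth z g []       ys = refl
sumTo-nth z g (x ∷ xs) ys = cong (g x +_) (sumTo-nth z g xs ys)

-- Levels and edges of the hypercube.

ones : V n → ℕ
ones []          = 0
ones (true  ∷ u) = suc (ones u)
ones (false ∷ u) = ones u

ones-sum : (u : V n) → sum (λ i → bit (lookup u i)) ≡ ones u
ones-sum []          = refl
ones-sum (true  ∷ u) = cong suc (ones-sum u)
ones-sum (false ∷ u) = ones-sum u

ones≤ : (u : V n) → ones u ≤ n
ones≤ []          = z≤n
ones≤ (true  ∷ u) = s≤s (ones≤ u)
ones≤ (false ∷ u) = m≤n⇒m≤1+n (ones≤ u)

𝟎 : V n
𝟎 = replicate _ false

𝟏 : V n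
𝟏 = replicate _ true

ones-𝟎 : ∀ n → ones (𝟎 {n}) ≡ 0
ones-𝟎 zero    = refl
ones-𝟎 (suc n) = ones-𝟎 n

ones-𝟏 : ∀ n → ones (𝟏 {n}) ≡ n
ones-𝟏 zero    = refl
ones-𝟏 (suc n) = cong suc (ones-𝟏 n)

ones≡0 : (u : V n) → ones u ≡ 0 → u ≡ 𝟎
ones≡0 []          _  = refl
ones≡0 (false ∷ u) eq = cong (false ∷_) (ones≡0 u eq)

flip : V n → Fin n → V n
flip u i = updateAt u i not

flip-involutive : (u : V n) (i : Fin n) → flip (flip u i) i ≡ u
flip-involutive u i = trans (updateAt-updateAt-local i {h = not ∘ not} u refl) (updateAt-id-local i u (not-involutive _))

flip-swap : {u v : V n} (i : Fin n) → flip u i ≡ v → u ≡ flip v i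
flip-swap {u = u} i refl = sym (flip-involutive u i)

flip-injective : (u : V n) {i j : Fin n} → flip u i ≡ flip u j → i ≡ j
flip-injective (true  ∷ u) {zero}  {zero}  eq = refl
flip-injective (false ∷ u) {zero}  {zero}  eq = refl
flip-injective (true  ∷ u) {zero}  {suc j} ()
flip-injective (false ∷ u) {zero}  {suc j} ()
flip-injective (true  ∷ u) {suc i} {zero}  ()
flip-injective (false ∷ u) {suc i} {zero}  ()
flip-injective (b ∷ u)     {suc i} {suc j} eq = cong suc (flip-injective u (∷-injectiveʳ eq))

lookup-flip : (u : V n) (i : Fin n) → lookup (flip u i) i ≡ not (lookup u i)
lookup-flip u i = lookup∘updateAt i u

-- Adding the old bit on one side and the new bit on the other treats upward and downward moves
-- alike and avoids truncated subtraction.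
ones-flip : (u : V n) (i : Fin n) → ones (flip u i) + bit (lookup u i) ≡ ones u + bit (not (lookup u i))
ones-flip (true  ∷ u) zero    = trans (+-comm (ones u) 1) (sym (+-identityʳ _))
ones-flip (false ∷ u) zero    = trans (+-identityʳ _) (+-comm 1 (ones u))
ones-flip (true  ∷ u) (suc i) = cong suc (ones-flip u i)
ones-flip (false ∷ u) (suc i) = ones-flip u i

-- `hamming` as a sum: unlike a filtered `allFin`, it unfolds along the vectors, which the
-- inductions below rely on.
dist : V n → V n → ℕ
dist u v = sum (λ i → ⟦ ¬? (lookup u i ≟B lookup v i) ⟧)

hamming≡dist : (u v : V n) → hamming u v ≡ dist u v
hamming≡dist u v = length-filter-tabulate (λ i → ¬? (lookup u i ≟B lookup v i)) id

dist-refl : (u : V n) → dist u u ≡ 0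
dist-refl []          = refl
dist-refl (true  ∷ u) = dist-refl u
dist-refl (false ∷ u) = dist-refl u

dist-flip : (u : V n) (i : Fin n) → dist u (flip u i) ≡ 1
dist-flip (true  ∷ u) zero    = cong suc (dist-refl u)
dist-flip (false ∷ u) zero    = cong suc (dist-refl u)
dist-flip (true  ∷ u) (suc i) = dist-flip u i
dist-flip (false ∷ u) (suc i) = dist-flip u i

dist≡0 : (u v : V n) → dist u v ≡ 0 → v ≡ u
dist≡0 []          []          _  = refl
dist≡0 (true  ∷ u) (true  ∷ v) eq = cong (true ∷_) (dist≡0 u v eq)
dist≡0 (false ∷ u) (false ∷ v) eq = cong (false ∷_) (dist≡0 u v eq)

dist≡1 : (u v : V n) → dist u v ≡ 1 → ∃ λ i → v ≡ flip u i
dist≡1 (true  ∷ u) (false ∷ v) eq = zero , cong (false ∷_) (dist≡0 u v (suc-injective eq))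
dist≡1 (false ∷ u) (true  ∷ v) eq = zero , cong (true ∷_) (dist≡0 u v (suc-injective eq))
dist≡1 (true  ∷ u) (true  ∷ v) eq with i , refl ← dist≡1 u v eq = suc i , refl
dist≡1 (false ∷ u) (false ∷ v) eq with i , refl ← dist≡1 u v eq = suc i , refl

Adj-flip : (u : V n) (i : Fin n) → Adj u (flip u i)
Adj-flip u i = trans (hamming≡dist u (flip u i)) (dist-flip u i)

Adj⇒flip : (u v : V n) → Adj u v → ∃ λ i → v ≡ flip u i
Adj⇒flip u v adj = dist≡1 u v (trans (sym (hamming≡dist u v)) adj)

-- The round followed by each rotor.

downs : V n → List (Fin n)
downs []          = []
downs (true  ∷ u) = zero ∷ map suc (downs u)
downs (false ∷ u) = map suc (downs u)

ups : V n → List (Fin n)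
ups []          = []
ups (true  ∷ u) = map suc (ups u)
ups (false ∷ u) = zero ∷ map suc (ups u)

length-downs : (u : V n) → length (downs u) ≡ ones u
length-downs []          = refl
length-downs (true  ∷ u) = cong suc (trans (length-map suc (downs u)) (length-downs u))
length-downs (false ∷ u) = trans (length-map suc (downs u)) (length-downs u)

length-ups : (u : V n) → ones u + length (ups u) ≡ n
length-ups []          = refl
length-ups (true  ∷ u) = cong suc (trans (cong (ones u +_) (length-map suc (ups u))) (length-ups u))
length-ups (false ∷ u) = trans (cong (λ k → ones u + suc k) (length-map suc (ups u))) (trans (+-suc (ones u) _) (cong suc (length-ups u)))

multiplicity : Fin n → List (Fin n) → ℕ
multiplicity i = sumL (λ j → ⟦ j ≟F i ⟧)

multiplicity-zero : (xs : List (Fin n)) → multiplicity zero (map suc xs) ≡ 0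
multiplicity-zero xs = trans (sumL-map _ suc xs) (sumL-0 xs)

multiplicity-suc : (i : Fin n) (xs : List (Fin n)) → multiplicity (suc i) (map suc xs) ≡ multiplicity i xs
multiplicity-suc i xs = sumL-map _ suc xs

multiplicity-downs : (u : V n) (i : Fin n) → multiplicity i (downs u) ≡ bit (lookup u i)
multiplicity-downs (true  ∷ u) zero    = cong suc (multiplicity-zero (downs u))
multiplicity-downs (false ∷ u) zero    = multiplicity-zero (downs u)
multiplicity-downs (true  ∷ u) (suc i) = trans (multiplicity-suc i (downs u)) (multiplicity-downs u i)
multiplicity-downs (false ∷ u) (suc i) = trans (multiplicity-suc i (downs u)) (multiplicity-downs u i)

multiplicity-ups : (u : V n) (i : Fin n) → multiplicity i (ups u) ≡ bit (not (lookup u i))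
multiplicity-ups (true  ∷ u) zero    = multiplicity-zero (ups u)
multiplicity-ups (false ∷ u) zero    = cong suc (multiplicity-zero (ups u))
multiplicity-ups (true  ∷ u) (suc i) = trans (multiplicity-suc i (ups u)) (multiplicity-ups u i)
multiplicity-ups (false ∷ u) (suc i) = trans (multiplicity-suc i (ups u)) (multiplicity-ups u i)

bit-not : ∀ b → bit b + bit (not b) ≡ 1
bit-not true  = refl
bit-not false = refl

order : V n → List (Fin n)
order u = downs u ++ ups u

length-order : (u : V n) → length (order u) ≡ n
length-order u = trans (length-++ (downs u)) (trans (cong (_+ length (ups u)) (length-downs u)) (length-ups u))

multiplicity-order : (u : V n) (i : Fin n) → multiplicity i (order u) ≡ 1
multiplicity-order u i = trans (sumL-++ _ (downs u) (ups u)) (trans (cong₂ _+_ (multiplicity-downs u i) (multiplicity-ups u i)) (bit-not (lookup u i)))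

-- Departures from a vertex, counted by direction.

-- Reducing `j` modulo the degree lets one formula serve rotors of every length `m u * d`. The
-- default `zero` is never read, as `order u` has length `suc n`.
port : V (suc n) → ℕ → Fin (suc n)
port {n} u j = nth zero (order u) (j % suc n)

port-cong : (u : V (suc n)) (j k : ℕ) → j % suc n ≡ k % suc n → port u j ≡ port u k
port-cong u j k = cong (nth zero (order u))

-- With all rotors starting at index zero, this is the traffic on the arc from `u` in direction `i`
-- after `k` departures from `u`.
exits : V (suc n) → Fin (suc n) → ℕ → ℕ
exits u i k = sumTo k (λ j → ⟦ port u j ≟F i ⟧)

exits-suc : (u : V (suc n)) (i : Fin (suc n)) (k : ℕ) → exits u i (suc k) ≡ exits u i k + ⟦ port u k ≟F i ⟧
exits-suc u i k = sumTo-suc k (λ j → ⟦ port u j ≟F i ⟧)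

exits-mono : (u : V (suc n)) (i : Fin (suc n)) {j k : ℕ} → j ≤ k → exits u i j ≤ exits u i k
exits-mono u i {j} {k} j≤k with l , refl ← m≤n⇒∃[o]m+o≡n j≤k = ≤-trans (m≤m+n _ _) (≤-reflexive (sym (sumTo-+ j l (λ j → ⟦ port u j ≟F i ⟧))))

exits-first : (u : V (suc n)) (i : Fin (suc n)) {k : ℕ} → k ≤ suc n →
              exits u i k ≡ sumTo k (λ j → ⟦ nth zero (order u) j ≟F i ⟧)
exits-first u i {k} k≤ = sumTo-cong k (λ j j<k → cong (λ m → ⟦ nth zero (order u) m ≟F i ⟧) (m<n⇒m%n≡m (≤-trans j<k k≤)))

-- The down-directions fill exactly the first `ones u` places of the round, each once.
exits-ones : (u : V (suc n)) (i : Fin (suc n)) → exits u i (ones u) ≡ bit (lookup u i)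
exits-ones u i = begin
  exits u i (ones u)                                  ≡⟨ exits-first u i (ones≤ u) ⟩
  sumTo (ones u) g                                    ≡⟨ cong (λ k → sumTo k g) (length-downs u) ⟨
  sumTo (length (downs u)) g                          ≡⟨ sumTo-nth zero (λ j → ⟦ j ≟F i ⟧) (downs u) (ups u) ⟩
  multiplicity i (downs u)                            ≡⟨ multiplicity-downs u i ⟩
  bit (lookup u i)                                    ∎
  where
  open ≡-Reasoning
  g : ℕ → ℕ
  g j = ⟦ nth zero (order u) j ≟F i ⟧

exits-round : (u : V (suc n)) (i : Fin (suc n)) → exits u i (suc n) ≡ 1
exits-round {n} u i = begin
  exits u i (suc n)            ≡⟨ exits-first u i ≤-refl ⟩
  sumTo (suc n) (g (order u))  ≡⟨ cong₂ (λ k xs → sumTo k (g xs)) (length-order u) (++-identityʳ (order u)) ⟨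
  sumTo (length (order u)) (g (order u ++ []))  ≡⟨ sumTo-nth zero (λ j → ⟦ j ≟F i ⟧) (order u) [] ⟩
  multiplicity i (order u)     ≡⟨ multiplicity-order u i ⟩
  1                            ∎
  where
  open ≡-Reasoning
  g : List (Fin (suc n)) → ℕ → ℕ
  g xs j = ⟦ nth zero xs j ≟F i ⟧

port-period : (u : V (suc n)) (q j : ℕ) → port u (q * suc n + j) ≡ port u j
port-period {n} u q j = port-cong u (q * suc n + j) j (trans (cong (_% suc n) (+-comm (q * suc n) j)) ([m+kn]%n≡m%n j q (suc n)))

-- Each full round uses every direction once and leaves the later ports unchanged.
exits-period : (u : V (suc n)) (i : Fin (suc n)) (q k : ℕ) → exits u i (q * suc n + k) ≡ q + exits u i k
exits-period u i zero    k = refl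
exits-period {n} u i (suc q) k = begin
  exits u i (suc n + q * suc n + k)                        ≡⟨ cong (exits u i) (+-assoc (suc n) (q * suc n) k) ⟩
  exits u i (suc n + (q * suc n + k))                      ≡⟨ sumTo-+ (suc n) (q * suc n + k) g ⟩
  exits u i (suc n) + sumTo (q * suc n + k) (λ j → g (suc n + j))  ≡⟨ cong₂ _+_ (exits-round u i) (sumTo-cong (q * suc n + k) (λ j _ → shift j)) ⟩
  1 + exits u i (q * suc n + k)                            ≡⟨ cong suc (exits-period u i q k) ⟩
  suc q + exits u i k                                      ∎
  where
  open ≡-Reasoning
  g : ℕ → ℕ
  g j = ⟦ port u j ≟F i ⟧
  shift : ∀ j → g (suc n + j) ≡ g j
  shift j = cong (λ p → ⟦ p ≟F i ⟧) (trans (cong (λ m → port u (m + j)) (sym (*-identityˡ (suc n)))) (port-period u 1 j))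

-- The direction taken at index `j` is counted among the first `ones u` exits, and by `exits-ones`
-- only down-directions are.
port-down : (u : V (suc n)) {j : ℕ} → suc j ≡ ones u → lookup u (port u j) ≡ true
port-down u {j} eq = bit⁻¹ (begin
  1                                          ≡⟨ ⟦⟧-yes (i ≟F i) refl ⟨
  ⟦ i ≟F i ⟧                                 ≤⟨ m≤n+m _ (exits u i j) ⟩
  exits u i j + ⟦ i ≟F i ⟧                   ≡⟨ exits-suc u i j ⟨
  exits u i (suc j)                          ≡⟨ cong (exits u i) eq ⟩
  exits u i (ones u)                         ≡⟨ exits-ones u i ⟩
  bit (lookup u i)                           ∎)
  where
  open ≤-Reasoning
  i = port u j
  bit⁻¹ : ∀ {b} → 1 ≤ bit b → b ≡ true
  bit⁻¹ {true} _ = refl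

-- Caps on the departures during the first phases.

-- The number of times u is left through coordinate i in the first k phases.
arcCap : ℕ → V n → Fin n → ℕ
arcCap k u i = k + bit (lookup u i) ∸ ones u

cap : ℕ → V n → ℕ
cap k u = sum (arcCap k u)

-- For an edge between levels l and l + 1 both ends give k ∸ l, so the caps on departures from `u`
-- also serve for arrivals at `u`.
arcCap-flip : (k : ℕ) (u : V n) (i : Fin n) → arcCap k (flip u i) i ≡ arcCap k u i
arcCap-flip k u i with lookup u i | lookup-flip u i | ones-flip u i
... | true  | eq | eq′ rewrite eq | +-comm (ones (flip u i)) 1 | +-identityʳ k | +-comm k 1 | +-identityʳ (ones u) | sym eq′ = refl
... | false | eq | eq′ rewrite eq | +-comm (ones u) 1 | +-identityʳ k | +-comm k 1 | +-identityʳ (ones (flip u i)) | eq′ = refl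

arcCap-near : (k : ℕ) (u : V n) (i : Fin n) → ones u ≤ k → arcCap k u i ≡ k ∸ ones u + bit (lookup u i)
arcCap-near k u i ≤k = +-∸-comm (bit (lookup u i)) ≤k

arcCap-far : (k : ℕ) (u : V n) (i : Fin n) → k < ones u → arcCap k u i ≡ 0
arcCap-far k u i k< = m≤n⇒m∸n≡0 (≤-trans (≤-trans (+-monoʳ-≤ k (bit≤1 (lookup u i))) (≤-reflexive (+-comm k 1))) k<)
  where
  bit≤1 : ∀ b → bit b ≤ 1
  bit≤1 true  = ≤-refl
  bit≤1 false = z≤n

-- The cap consists of `k ∸ ones u` full rounds and the downward beginning of one more.
cap-near : (k : ℕ) (u : V n) → ones u ≤ k → cap k u ≡ (k ∸ ones u) * n + ones u
cap-near {n} k u ≤k = begin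
  sum (arcCap k u)                                            ≡⟨ sum-cong-≗ (λ i → arcCap-near k u i ≤k) ⟩
  sum (λ i → k ∸ ones u + bit (lookup u i))                   ≡⟨ ∑-distrib-+ (λ _ → k ∸ ones u) (λ i → bit (lookup u i)) ⟩
  sum {n} (λ _ → k ∸ ones u) + sum (λ i → bit (lookup u i))   ≡⟨ cong₂ _+_ (trans (sum-const n _) (*-comm n _)) (ones-sum u) ⟩
  (k ∸ ones u) * n + ones u                                   ∎
  where open ≡-Reasoning

cap-far : (k : ℕ) (u : V n) → k < ones u → cap k u ≡ 0
cap-far {n} k u k< = trans (sum-cong-≗ (λ i → arcCap-far k u i k<)) (sum-replicate-zero n)

-- A vertex at its cap has just finished the downward part of a round, so the unfinished round
-- contributes exactly the bit at `i`.
exits-cap : (k : ℕ) (u : V (suc n)) (i : Fin (suc n)) → exits u i (cap k u) ≡ arcCap k u i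
exits-cap {n} k u i with ones u ≤? k
... | yes ≤k = begin
  exits u i (cap k u)                           ≡⟨ cong (exits u i) (cap-near k u ≤k) ⟩
  exits u i ((k ∸ ones u) * suc n + ones u)     ≡⟨ exits-period u i (k ∸ ones u) (ones u) ⟩
  k ∸ ones u + exits u i (ones u)               ≡⟨ cong (k ∸ ones u +_) (exits-ones u i) ⟩
  k ∸ ones u + bit (lookup u i)                 ≡⟨ arcCap-near k u i ≤k ⟨
  arcCap k u i                                  ∎
  where open ≡-Reasoning
... | no ≰k = trans (cong (exits u i) (cap-far k u (≰⇒> ≰k))) (sym (arcCap-far k u i (≰⇒> ≰k)))

cap-𝟎 : ∀ k n → cap k (𝟎 {n}) ≡ k * n
cap-𝟎 k n = trans (cap-near k (𝟎 {n}) (≤-trans (≤-reflexive (ones-𝟎 n)) z≤n)) (trans (cong (λ l → (k ∸ l) * n + l) (ones-𝟎 n)) (+-identityʳ _))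

-- The last exit that completes the cap goes down, as rounds start with the down-neighbours.
down-deficit : (k : ℕ) (u : V (suc n)) {l c : ℕ} → ones u ≡ suc l → c < cap k u →
               ∃ λ i → lookup u i ≡ true × exits u i c < arcCap k u i
down-deficit {n} k u {l} {c} eq c<cap with ones u ≤? k
... | no ≰k = contradiction c<cap (λ c<cap → n≮0 (subst (c <_) (cap-far k u (≰⇒> ≰k)) c<cap))
... | yes ≤k = port u c′ , down , (begin-strict
  exits u (port u c′) c                                  ≤⟨ exits-mono u _ (≤-pred (subst (c <_) cap≡ c<cap)) ⟩
  exits u (port u c′) c′                                 <⟨ ≤-reflexive (+-comm 1 _) ⟩
  exits u (port u c′) c′ + 1                             ≡⟨ cong (exits u (port u c′) c′ +_) (⟦⟧-yes (port u c′ ≟F port u c′) refl) ⟨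
  exits u (port u c′) c′ + ⟦ port u c′ ≟F port u c′ ⟧    ≡⟨ exits-suc u _ c′ ⟨
  exits u (port u c′) (suc c′)                           ≡⟨ cong (exits u _) cap≡ ⟨
  exits u (port u c′) (cap k u)                          ≡⟨ exits-cap k u _ ⟩
  arcCap k u (port u c′)                                 ∎)
  where
  open ≤-Reasoning
  c′ = (k ∸ ones u) * suc n + l
  cap≡ : cap k u ≡ suc c′
  cap≡ = trans (cap-near k u ≤k) (trans (cong ((k ∸ ones u) * suc n +_) eq) (+-suc ((k ∸ ones u) * suc n) l))
  down : lookup u (port u c′) ≡ true
  down = trans (cong (lookup u) (port-period u (k ∸ ones u) l)) (port-down u (sym eq))

-- Sums over all vertices and the total of the caps.

sumV : ∀ n → (V n → ℕ) → ℕ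
sumV zero    f = f []
sumV (suc n) f = sumV n (f ∘ (false ∷_)) + sumV n (f ∘ (true ∷_))

sumV-mono-≤ : ∀ n {f g : V n → ℕ} → (∀ u → f u ≤ g u) → sumV n f ≤ sumV n g
sumV-mono-≤ zero    f≤g = f≤g []
sumV-mono-≤ (suc n) f≤g = +-mono-≤ (sumV-mono-≤ n (f≤g ∘ (false ∷_))) (sumV-mono-≤ n (f≤g ∘ (true ∷_)))

sumV-cong : ∀ n {f g : V n → ℕ} → (∀ u → f u ≡ g u) → sumV n f ≡ sumV n g
sumV-cong n f≡g = ≤-antisym (sumV-mono-≤ n (≤-reflexive ∘ f≡g)) (sumV-mono-≤ n (≤-reflexive ∘ sym ∘ f≡g))

sumV-+ : ∀ n (f g : V n → ℕ) → sumV n (λ u → f u + g u) ≡ sumV n f + sumV n g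
sumV-+ zero    f g = refl
sumV-+ (suc n) f g = trans (cong₂ _+_ (sumV-+ n (f ∘ (false ∷_)) (g ∘ (false ∷_))) (sumV-+ n (f ∘ (true ∷_)) (g ∘ (true ∷_))))
  (interchange (sumV n (f ∘ (false ∷_))) _ _ _)
  where
  interchange : ∀ a b c d → (a + b) + (c + d) ≡ (a + c) + (b + d)
  interchange = solve-∀

sumV-const : ∀ n c → sumV n (λ _ → c) ≡ nV n * c
sumV-const zero    c = sym (*-identityˡ c)
sumV-const (suc n) c = trans (cong₂ _+_ (sumV-const n c) (sumV-const n c)) (double (nV n) c)
  where
  double : ∀ a c → a * c + a * c ≡ (2 * a) * c
  double = solve-∀

sumV-* : ∀ n c (f : V n → ℕ) → sumV n (λ u → c * f u) ≡ c * sumV n f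
sumV-* zero    c f = refl
sumV-* (suc n) c f = trans (cong₂ _+_ (sumV-* n c (f ∘ (false ∷_))) (sumV-* n c (f ∘ (true ∷_)))) (sym (*-distribˡ-+ c (sumV n (f ∘ (false ∷_))) (sumV n (f ∘ (true ∷_)))))

sumV-δ : ∀ n (x : V n) → sumV n (λ u → ⟦ x ≟V u ⟧) ≡ 1
sumV-δ zero    []          = refl
sumV-δ (suc n) (true  ∷ x) = cong₂ _+_ (trans (sumV-const n 0) (*-zeroʳ (nV n))) (sumV-δ n x)
sumV-δ (suc n) (false ∷ x) = cong₂ _+_ (sumV-δ n x) (trans (sumV-const n 0) (*-zeroʳ (nV n)))

-- The average level is n / 2; doubling keeps the induction in ℕ.
sumV-ones : ∀ n → 2 * sumV n ones ≡ n * nV n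
sumV-ones zero    = refl
sumV-ones (suc n) = begin
  2 * (sumV n ones + sumV n (λ u → 1 + ones u))       ≡⟨ cong (λ s → 2 * (sumV n ones + s)) (trans (sumV-+ n (λ _ → 1) ones) (cong (_+ sumV n ones) (sumV-const n 1))) ⟩
  2 * (sumV n ones + (nV n * 1 + sumV n ones))        ≡⟨ lemma₁ (sumV n ones) (nV n) ⟩
  2 * (2 * sumV n ones) + 2 * nV n                    ≡⟨ cong (λ s → 2 * s + 2 * nV n) (sumV-ones n) ⟩
  2 * (n * nV n) + 2 * nV n                           ≡⟨ lemma₂ n (nV n) ⟩
  suc n * (2 * nV n)                                  ∎
  where
  open ≡-Reasoning
  lemma₁ : ∀ s a → 2 * (s + (a * 1 + s)) ≡ 2 * (2 * s) + 2 * a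
  lemma₁ = solve-∀
  lemma₂ : ∀ n a → 2 * (n * a) + 2 * a ≡ suc n * (2 * a)
  lemma₂ = solve-∀

-- For `k = e` the cap is linear in the level, even at the top level, where it vanishes. This
-- reduces its total to `sumV-ones`.
cap-linear : ∀ e (u : V (suc e)) → cap e u + e * ones u ≡ e * suc e
cap-linear e u with ones u ≤? e
... | yes ≤e = begin
  cap e u + e * l                        ≡⟨ cong (_+ e * l) (cap-near e u ≤e) ⟩
  (e ∸ l) * suc e + l + e * l            ≡⟨ lemma (e ∸ l) e l ⟩
  (e ∸ l + l) * suc e                    ≡⟨ cong (_* suc e) (m∸n+n≡m ≤e) ⟩
  e * suc e                              ∎
  where
  open ≡-Reasoning
  l = ones u
  lemma : ∀ x e l → x * suc e + l + e * l ≡ (x + l) * suc e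
  lemma = solve-∀
-- The only level above `e` is `suc e`.
... | no ≰e = cong₂ (λ c l → c + e * l) (cap-far e u (≰⇒> ≰e)) (≤-antisym (ones≤ u) (≰⇒> ≰e))

sumV-cap : ∀ e → 2 * sumV (suc e) (cap e) ≡ nV (suc e) * (e * suc e)
-- The total of `e * ones u`, doubled, is added to both sides so that `cap-linear` applies without
-- subtraction.
sumV-cap e = +-cancelʳ-≡ (e * (suc e * N)) _ _ (begin
  2 * S + e * (suc e * N)                         ≡⟨ cong (λ s → 2 * S + e * s) (sumV-ones (suc e)) ⟨
  2 * S + e * (2 * L)                             ≡⟨ lemma₁ S e L ⟩
  2 * (S + e * L)                                 ≡⟨ cong (λ s → 2 * (S + s)) (sumV-* (suc e) e ones) ⟨
  2 * (S + sumV (suc e) (λ u → e * ones u))       ≡⟨ cong (2 *_) (sumV-+ (suc e) (cap e) (λ u → e * ones u)) ⟨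
  2 * sumV (suc e) (λ u → cap e u + e * ones u)   ≡⟨ cong (2 *_) (trans (sumV-cong (suc e) (cap-linear e)) (sumV-const (suc e) (e * suc e))) ⟩
  2 * (N * (e * suc e))                           ≡⟨ lemma₂ N e ⟩
  N * (e * suc e) + e * (suc e * N)               ∎)
  where
  open ≡-Reasoning
  N = nV (suc e)
  S = sumV (suc e) (cap e)
  L = sumV (suc e) ones
  lemma₁ : ∀ s e l → 2 * s + e * (2 * l) ≡ 2 * (s + e * l)
  lemma₁ = solve-∀
  lemma₂ : ∀ n e → 2 * (n * (e * suc e)) ≡ n * (e * suc e) + e * (suc e * n)
  lemma₂ = solve-∀

-- Rotor positions modulo the round length.

-- Wrapping around at `n` is invisible modulo a divisor `d` of `n`.
cyc-toℕ-% : ∀ {n} (i : Fin n) (d : ℕ) .{{_ : NonZero d}} → n % d ≡ 0 → toℕ (cyc i) % d ≡ suc (toℕ i) % d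
cyc-toℕ-% {suc n} i d eq with suc (toℕ i) <? suc n
... | yes p = cong (_% d) (toℕ-fromℕ< p)
... | no ¬p = trans (m*n%n≡0 0 d) (trans (sym eq) (cong (_% d) (≤-antisym (≮⇒≥ ¬p) (toℕ<n i))))

suc-%-cong : ∀ {a b} d .{{_ : NonZero d}} → a % d ≡ b % d → suc a % d ≡ suc b % d
suc-%-cong {a} {b} d eq = trans (%-distribˡ-+ 1 a d) (trans (cong (λ r → (1 % d + r) % d) eq) (sym (%-distribˡ-+ 1 b d)))

-- Decidability of coverage and least times.

∀V? : ∀ n {P : V n → Set} → (∀ u → Dec (P u)) → Dec (∀ u → P u)
∀V? zero    P? = map′ (λ { p [] → p }) (λ p → p []) (P? [])
∀V? (suc n) P? = map′ (λ { (p , q) (false ∷ u) → p u ; (p , q) (true ∷ u) → q u })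
                          (λ p → p ∘ (false ∷_) , p ∘ (true ∷_))
                          (∀V? n (P? ∘ (false ∷_)) ×-dec ∀V? n (P? ∘ (true ∷_)))

-- Turns any time by which everything is visited into the exact cover time that `IsCoverTime`
-- demands.
least : {P : ℕ → Set} → (∀ t → Dec (P t)) → ∀ t → P t → ∃ λ s → P s × (∀ r → r < s → ¬ P r)
least P? zero    p = zero , p , λ r ()
least P? (suc t) p with P? zero
... | yes p₀ = zero , p₀ , λ r ()
... | no ¬p₀ with s , pₛ , below ← least (P? ∘ suc) t p =
  suc s , pₛ , λ { zero _ → ¬p₀ ; (suc r) (s≤s r<s) → below r r<s }

allVisited? : ∀ {d m} (R : RotorSystem d m) (s : State d m) (t : ℕ) → Dec (AllVisited R s t)
allVisited? {d} R s t = ∀V? d (λ v → map′ (λ { (t′ , s≤s t′≤t , eq) → t′ , t′≤t , eq })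
                                              (λ { (t′ , t′≤t , eq) → t′ , s≤s t′≤t , eq })
                                              (anyUpTo? (λ t′ → proj₁ (walk R s t′) ≟V v) (suc t)))

-- The walk with downs-first rotors.

module DownsFirst {e : ℕ} (m : V (suc e) → ℕ) (m≥1 : ∀ u → 1 ≤ m u) where

  d : ℕ
  d = suc e

  exit : (u : V d) → Fin (m u * d) → V d
  exit u i = flip u (port u (toℕ i))

  rotors : RotorSystem d m
  rotors .rotor = exit
  rotors .rotorAdj u i = Adj-flip u (port u (toℕ i))
  rotors .rotorMult u v adj with i , refl ← Adj⇒flip u v adj = begin
    countEq _≟V_ (exit u) (flip u i)                                    ≡⟨ length-filter-tabulate {n = m u * d} (λ j → exit u j ≟V flip u i) id ⟩
    -- Distinct coordinates lead to distinct neighbours, so counting a neighbour is counting a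
    -- coordinate.
    sum {m u * d} (λ j → ⟦ exit u j ≟V flip u i ⟧)                      ≡⟨ sum-cong-≗ {m u * d} (λ j → ⟦⟧-cong (exit u j ≟V flip u i) (port u (toℕ j) ≟F i) (flip-injective u) (cong (flip u))) ⟩
    exits u i (m u * d)                                                 ≡⟨ cong (exits u i) (+-identityʳ (m u * d)) ⟨
    exits u i (m u * d + 0)                                             ≡⟨ exits-period u i (m u) 0 ⟩
    m u + 0                                                             ≡⟨ +-identityʳ (m u) ⟩
    m u                                                                 ∎
    where open ≡-Reasoning

  start : State d m
  start = 𝟎 , λ u → fromℕ< {0} (*-mono-≤ (m≥1 u) (s≤s (z≤n {e})))

  at : ℕ → V d
  at t = proj₁ (walk rotors start t)

  -- Time `t` itself is not counted, so these are the departures from `u` before `t`, the quantity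
  -- that governs the rotor.
  visits : V d → ℕ → ℕ
  visits u zero    = 0
  visits u (suc t) = visits u t + ⟦ at t ≟V u ⟧

  advance-% : (p : Positions d m) (x u : V d) (k : ℕ) → toℕ (p u) % d ≡ k % d →
              toℕ (advance {d} {m} p x u) % d ≡ (k + ⟦ x ≟V u ⟧) % d
  advance-% p x u k eq with u ≟V x
  ... | yes refl = begin
    toℕ (cyc (p u)) % d       ≡⟨ cyc-toℕ-% (p u) d (m*n%n≡0 (m u) d) ⟩
    suc (toℕ (p u)) % d       ≡⟨ suc-%-cong d eq ⟩
    suc k % d                 ≡⟨ cong (_% d) (+-comm 1 k) ⟩
    (k + 1) % d               ≡⟨ cong (λ c → (k + c) % d) (⟦⟧-yes (u ≟V u) refl) ⟨
    (k + ⟦ u ≟V u ⟧) % d      ∎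
    where open ≡-Reasoning
  ... | no u≢x = trans eq (cong (_% d) (sym (trans (cong (k +_) (⟦⟧-no (x ≟V u) (u≢x ∘ sym))) (+-identityʳ k))))

  -- The residue modulo `d` is all that `port` reads; the position itself wraps at `m u * d`.
  position-% : (t : ℕ) (u : V d) → toℕ (proj₂ (walk rotors start t) u) % d ≡ visits u t % d
  position-% zero    u = cong (_% d) (toℕ-fromℕ< (*-mono-≤ (m≥1 u) (s≤s (z≤n {e}))))
  position-% (suc t) u = advance-% (proj₂ (walk rotors start t)) (at t) u (visits u t) (position-% t u)

  at-suc : (t : ℕ) → at (suc t) ≡ flip (at t) (port (at t) (visits (at t) t))
  at-suc t = cong (flip (at t)) (port-cong (at t) (toℕ (proj₂ (walk rotors start t) (at t))) (visits (at t) t) (position-% t (at t)))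

  -- Conservation of flow.

  inflow : V d → ℕ → ℕ
  inflow u t = sum (λ i → exits (flip u i) i (visits (flip u i) t))

  -- One step changes the traffic of a single arc, the one leaving `at t` through the current port
  -- `j`; it enters `u` exactly when `at t` is `flip u j`.
  inflow-suc : (u : V d) (t : ℕ) → inflow u (suc t) ≡ inflow u t + ⟦ at (suc t) ≟V u ⟧
  inflow-suc u t = begin
    inflow u (suc t)                                                ≡⟨ sum-cong-≗ arc ⟩
    sum (λ i → before i + ⟦ x ≟V flip u i ⟧ * ⟦ j ≟F i ⟧)           ≡⟨ ∑-distrib-+ before (λ i → ⟦ x ≟V flip u i ⟧ * ⟦ j ≟F i ⟧) ⟩
    inflow u t + sum (λ i → ⟦ x ≟V flip u i ⟧ * ⟦ j ≟F i ⟧)         ≡⟨ cong (inflow u t +_) (sum-δ (λ i → ⟦ x ≟V flip u i ⟧) j) ⟩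
    inflow u t + ⟦ x ≟V flip u j ⟧                                  ≡⟨ cong (inflow u t +_) (⟦⟧-cong (x ≟V flip u j) (at (suc t) ≟V u)
                                                                         (λ eq → trans (at-suc t) (sym (flip-swap j (sym eq))))
                                                                         (λ eq → flip-swap j (trans (sym (at-suc t)) eq))) ⟩
    inflow u t + ⟦ at (suc t) ≟V u ⟧                                ∎
    where
    open ≡-Reasoning
    x = at t
    j = port x (visits x t)
    before : Fin d → ℕ
    before i = exits (flip u i) i (visits (flip u i) t)
    arc : ∀ i → exits (flip u i) i (visits (flip u i) (suc t)) ≡ before i + ⟦ x ≟V flip u i ⟧ * ⟦ j ≟F i ⟧
    arc i with x ≟V flip u i
    ... | yes eq = begin
      exits (flip u i) i (k + 1)                                          ≡⟨ cong (exits (flip u i) i) (+-comm k 1) ⟩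
      exits (flip u i) i (suc k)                                          ≡⟨ exits-suc (flip u i) i k ⟩
      before i + ⟦ port (flip u i) k ≟F i ⟧                               ≡⟨ cong (λ y → before i + ⟦ port y (visits y t) ≟F i ⟧) eq ⟨
      before i + ⟦ j ≟F i ⟧                                               ≡⟨ cong (before i +_) (+-identityʳ _) ⟨
      before i + (⟦ j ≟F i ⟧ + 0)                                         ∎
      where k = visits (flip u i) t
    ... | no _ = trans (cong (exits (flip u i) i) (+-identityʳ (visits (flip u i) t))) (sym (+-identityʳ (before i)))

  -- The start acts as an extra arrival and the present position as a departure still to come.
  conservation : (u : V d) (t : ℕ) → inflow u t + ⟦ 𝟎 ≟V u ⟧ ≡ visits u t + ⟦ at t ≟V u ⟧
  conservation u zero    = cong (_+ ⟦ 𝟎 ≟V u ⟧) (sum-replicate-zero d)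
  conservation u (suc t) = begin
    inflow u (suc t) + ⟦ 𝟎 ≟V u ⟧                           ≡⟨ cong (_+ ⟦ 𝟎 ≟V u ⟧) (inflow-suc u t) ⟩
    inflow u t + ⟦ at (suc t) ≟V u ⟧ + ⟦ 𝟎 ≟V u ⟧           ≡⟨ +-assoc (inflow u t) _ _ ⟩
    inflow u t + (⟦ at (suc t) ≟V u ⟧ + ⟦ 𝟎 ≟V u ⟧)         ≡⟨ cong (inflow u t +_) (+-comm ⟦ at (suc t) ≟V u ⟧ _) ⟩
    inflow u t + (⟦ 𝟎 ≟V u ⟧ + ⟦ at (suc t) ≟V u ⟧)         ≡⟨ +-assoc (inflow u t) _ _ ⟨
    inflow u t + ⟦ 𝟎 ≟V u ⟧ + ⟦ at (suc t) ≟V u ⟧           ≡⟨ cong (_+ ⟦ at (suc t) ≟V u ⟧) (conservation u t) ⟩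
    visits u (suc t) + ⟦ at (suc t) ≟V u ⟧                  ∎
    where open ≡-Reasoning

  -- Each step is one departure, which converts departure counts into elapsed time.
  total-visits : (t : ℕ) → sumV d (λ u → visits u t) ≡ t
  total-visits zero    = trans (sumV-const d 0) (*-zeroʳ (nV d))
  total-visits (suc t) = trans (sumV-+ d (λ u → visits u t) (λ u → ⟦ at t ≟V u ⟧)) (trans (cong₂ _+_ (total-visits t) (sumV-δ d (at t))) (+-comm t 1))

  visits-≤-suc : (u : V d) (t : ℕ) → visits u t ≤ visits u (suc t)
  visits-≤-suc u t = m≤m+n (visits u t) _

  visited : (u : V d) (t : ℕ) → 1 ≤ visits u t → ∃ λ s → s < t × at s ≡ u
  visited u (suc t) v≥1 with at t ≟V u
  ... | yes eq = t , ≤-refl , eq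
  ... | no  _  with s , s<t , eq ← visited u t (subst (1 ≤_) (+-identityʳ _) v≥1) = s , m≤n⇒m≤1+n s<t , eq

  -- Upper and lower bounds for a phase.

  inflow-≤-cap : (k t : ℕ) → (∀ u → visits u t ≤ cap k u) → ∀ u i →
                 exits (flip u i) i (visits (flip u i) t) ≤ arcCap k u i
  inflow-≤-cap k t v≤ u i = begin
    exits (flip u i) i (visits (flip u i) t)   ≤⟨ exits-mono (flip u i) i (v≤ (flip u i)) ⟩
    exits (flip u i) i (cap k (flip u i))      ≡⟨ exits-cap k (flip u i) i ⟩
    arcCap k (flip u i) i                      ≡⟨ arcCap-flip k u i ⟩
    arcCap k u i                               ∎
    where open ≤-Reasoning

  -- Induction on time; only the vertex being left needs an argument. At `𝟎` the hypothesis bounds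
  -- it; elsewhere each departure needs an arrival, and the arrivals are capped by induction.
  visits-≤-cap : (k t : ℕ) → visits 𝟎 t ≤ k * d → ∀ u → visits u t ≤ cap k u
  visits-≤-cap k zero    _   u = z≤n
  visits-≤-cap k (suc t) v₀≤ u with at t ≟V u | 𝟎 ≟V u | conservation u t
  ... | no _  | _        | _     = subst (_≤ cap k u) (sym (+-identityʳ _)) (visits-≤-cap k t (≤-trans (visits-≤-suc 𝟎 t) v₀≤) u)
  ... | yes x | yes refl | _     = subst₂ _≤_ (cong (visits 𝟎 t +_) (⟦⟧-yes (at t ≟V 𝟎) x)) (sym (cap-𝟎 k d)) v₀≤
  ... | yes _ | no _     | flow  = begin
    visits u t + 1   ≡⟨ flow ⟨
    inflow u t + 0   ≡⟨ +-identityʳ _ ⟩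
    inflow u t       ≤⟨ sum-mono-≤ (inflow-≤-cap k t (visits-≤-cap k t (≤-trans (visits-≤-suc 𝟎 t) v₀≤)) u) ⟩
    cap k u          ∎
    where open ≤-Reasoning

  -- The count at `𝟎` grows by at most one per step, so the step that lifts it above `k * d` leaves
  -- `𝟎` with the count equal to `k * d`.
  phase-end : (k t : ℕ) → k * d < visits 𝟎 t → ∃ λ s → s < t × visits 𝟎 s ≡ k * d × at s ≡ 𝟎
  phase-end k (suc t) k< with k * d <? visits 𝟎 t
  ... | yes k<′ with s , s<t , rest ← phase-end k t k<′ = s , m≤n⇒m≤1+n s<t , rest
  phase-end k (suc t) k< | no k≮ with at t ≟V 𝟎
  ... | yes x = t , ≤-refl , ≤-antisym (≮⇒≥ k≮) (≤-pred (≤-trans k< (≤-reflexive (+-comm _ 1)))) , x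
  ... | no  _ = contradiction (subst (k * d <_) (+-identityʳ _) k<) k≮

  -- Induction on the level. A vertex below its cap is short on some downward arc; the lower end `w`
  -- has met its cap by induction, yet would have too few arrivals.
  cap-≤-visits : (k s : ℕ) → visits 𝟎 s ≡ k * d → at s ≡ 𝟎 → ∀ l u → ones u ≡ l → cap k u ≤ visits u s
  cap-≤-visits k s v₀ x zero    u eq with refl ← ones≡0 u eq = ≤-reflexive (trans (cap-𝟎 k d) (sym v₀))
  cap-≤-visits k s v₀ x (suc l) u eq = ≮⇒≥ λ v<cap →
    let i , down , deficit = down-deficit k u eq v<cap
        w = flip u i
        ones-w : ones w ≡ l
        ones-w = suc-injective (begin-equality
          suc (ones w)                       ≡⟨ +-comm 1 (ones w) ⟩
          ones w + 1                         ≡⟨ cong (λ b → ones w + bit b) down ⟨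
          ones w + bit (lookup u i)          ≡⟨ ones-flip u i ⟩
          ones u + bit (not (lookup u i))    ≡⟨ cong (λ b → ones u + bit (not b)) down ⟩
          ones u + 0                         ≡⟨ +-identityʳ (ones u) ⟩
          ones u                             ≡⟨ eq ⟩
          suc l                              ∎)
        -- The walk is back at its start `𝟎`, so both indicators in `conservation` agree.
        inflow-w : inflow w s ≡ visits w s
        inflow-w = +-cancelʳ-≡ ⟦ 𝟎 ≟V w ⟧ _ _ (trans (conservation w s) (cong (λ y → visits w s + ⟦ y ≟V w ⟧) x))
    in n≮n (cap k w) (begin-strict
      cap k w       ≤⟨ cap-≤-visits k s v₀ x l w ones-w ⟩
      visits w s    ≡⟨ inflow-w ⟨
      -- Every arc into `w` is capped, and the one from `u` is strictly below its cap.
      inflow w s    <⟨ sum-mono-< (inflow-≤-cap k s (visits-≤-cap k s (≤-reflexive v₀)) w) i (begin-strict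
        exits (flip w i) i (visits (flip w i) s)   ≡⟨ cong (λ y → exits y i (visits y s)) (flip-involutive u i) ⟩
        exits u i (visits u s)                     <⟨ deficit ⟩
        arcCap k u i                               ≡⟨ arcCap-flip k u i ⟨
        arcCap k w i                               ∎) ⟩
      cap k w       ∎)
    where open ≤-Reasoning

  -- Covering, and the late arrival at the antipode.

  all-visited : ∃ (AllVisited rotors start)
  all-visited = t , λ v → let s′ , s′<s , eq = visited v s (≤-trans (cap≥1 v) (cap-≤-visits d s v₀ x (ones v) v refl))
                          in s′ , <⇒≤ (<-trans s′<s s<t) , eq
    where
    -- One more than the total of the caps: if they still held at `t`, the total number of
    -- departures would be less than `t`.
    t = suc (sumV d (cap d))
    d*d<v₀ : d * d < visits 𝟎 t
    d*d<v₀ = ≰⇒> λ v₀≤ → n≮n (sumV d (cap d)) (subst (_≤ sumV d (cap d)) (total-visits t) (sumV-mono-≤ d (visits-≤-cap d t v₀≤)))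
    end = phase-end d t d*d<v₀
    s = proj₁ end
    s<t = proj₁ (proj₂ end)
    v₀ = proj₁ (proj₂ (proj₂ end))
    x = proj₂ (proj₂ (proj₂ end))
    -- At `𝟎` the full rounds make the cap positive, elsewhere the summand `ones v` does.
    cap≥1 : ∀ v → 1 ≤ cap d v
    cap≥1 v = subst (1 ≤_) (sym (cap-near d v (ones≤ v))) (nonzero (ones v) refl)
      where
      nonzero : ∀ l → ones v ≡ l → 1 ≤ (d ∸ l) * d + l
      nonzero zero    _ = s≤s z≤n
      nonzero (suc l) _ = ≤-trans (s≤s z≤n) (m≤n+m (suc l) ((d ∸ suc l) * d))

  -- If phase `e` has ended at some `s < t`, at least `sumV d (cap e)` departures precede `s`.
  -- Otherwise all caps hold, and that of `𝟏` is zero as its level `d` exceeds `e`, so nothing has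
  -- arrived there.
  reach-𝟏 : (t : ℕ) → at t ≡ 𝟏 → sumV d (cap e) < t
  reach-𝟏 t x with e * d <? visits 𝟎 t
  ... | yes e< with s , s<t , v₀ , x₀ ← phase-end e t e< =
    ≤-<-trans (subst (sumV d (cap e) ≤_) (total-visits s) (sumV-mono-≤ d (λ u → cap-≤-visits e s v₀ x₀ (ones u) u refl))) s<t
  ... | no e≮ = contradiction (begin
    1                                    ≡⟨ ⟦⟧-yes (at t ≟V 𝟏) x ⟨
    ⟦ at t ≟V 𝟏 ⟧                        ≤⟨ m≤n+m _ (visits 𝟏 t) ⟩
    visits 𝟏 t + ⟦ at t ≟V 𝟏 ⟧           ≡⟨ conservation 𝟏 t ⟨
    -- The `0` is the start indicator at `𝟏`, which differs from `𝟎` because `d` is positive.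
    inflow 𝟏 t + 0                       ≡⟨ +-identityʳ (inflow 𝟏 t) ⟩
    inflow 𝟏 t                           ≤⟨ sum-mono-≤ (inflow-≤-cap e t (visits-≤-cap e t (≮⇒≥ e≮)) 𝟏) ⟩
    cap e (𝟏 {d})                        ≡⟨ cap-far e (𝟏 {d}) (≤-reflexive (sym (ones-𝟏 d))) ⟩
    0                                    ∎) λ ()
    where open ≤-Reasoning

  cover-time : VCAtLeast d m (suc (sumV d (cap e)))
  cover-time with t , visited-t , below ← least (allVisited? rotors start) (proj₁ all-visited) (proj₂ all-visited) =
    rotors , start , t , (visited-t , below) ,
    let t′ , t′≤t , x = visited-t 𝟏 in ≤-trans (reach-𝟏 t′ x) t′≤t

-- The numerical bound.

-- With log n = d, the factor 4 means c = 1/4. Four times the total of the caps is 2 n d (d - 1),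
-- which is at least n d² for d ≥ 2; for d = 1 that total is zero and the `suc` is what suffices.
cover-bound : ∀ e → nV (suc e) * (suc e * suc e) ≤ 4 * suc (sumV (suc e) (cap e))
cover-bound zero    = s≤s (s≤s z≤n)
cover-bound (suc e) = begin
  N * (d * d)                        ≤⟨ m≤m+n _ (N * (e * d)) ⟩
  N * (d * d) + N * (e * d)          ≡⟨ lemma N e ⟩
  2 * (N * (suc e * d))              ≡⟨ cong (2 *_) (sumV-cap (suc e)) ⟨
  2 * (2 * S)                        ≡⟨ *-assoc 2 2 S ⟨
  4 * S                              ≤⟨ *-monoʳ-≤ 4 (n≤1+n S) ⟩
  4 * suc S                          ∎
  where
  open ≤-Reasoning
  d = suc (suc e)
  N = nV d
  S = sumV d (cap (suc e))
  lemma : ∀ n e → n * (suc (suc e) * suc (suc e)) + n * (e * suc (suc e)) ≡ 2 * (n * (suc e * suc (suc e)))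
  lemma = solve-∀

theorem4p8 : Σ ℕ λ K → 1 ≤ K × ((d : ℕ) → 1 ≤ d → (m : V d → ℕ) → (∀ u → 1 ≤ m u) →
    Σ ℕ λ T → VCAtLeast d m T × nV d * (d * d) ≤ K * T)
theorem4p8 = 4 , s≤s z≤n , λ { (suc e) _ m m≥1 → suc (sumV (suc e) (cap e)) , DownsFirst.cover-time m m≥1 , cover-bound e }
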